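{- Let $\Omega$ be an atomless Borel probability space with measure $\nu$ and let $W:\Omega^2\to[0,1]$ be a bipartite graphon. Then every extreme point $\mathfrak c$ of the set $\mathrm{FCOV}(W)$ of all fractional vertex covers of $W$ is integral, i.e. $\mathfrak c(x)\in\{0,1\}$ for almost every $x\in\Omega$.
   Context: A graphon is a symmetric measurable function $W:\Omega^2\to[0,1]$. Write $\operatorname{supp} W=\{(x,y): W(x,y)>0\}$. A graphon $W$ is bipartite if there is a partition $\Omega=\Omega_1\sqcup\Omega_2$ into measurable sets such that for $i=1,2$, $W=0$ almost everywhere on $\Omega_i\times\Omega_i$. A fractional vertex cover of $W$ is a function $\mathfrak c\in L^\infty(\Omega)$ such that $0\le\mathfrak c\le 1$ almost everywhere and the set $\operatorname{supp}W\setminus\{(x,y):\mathfrak c(x)+\mathfrak c(y)\ge 1\}$ has $\nu^{\otimes 2}$-measure $0$. $\mathrm{FCOV}(W)\subseteq L^\infty(\Omega)$ is the (convex) set of all fractional vertex covers of $W$. A point $x$ of a convex set $X$ is extreme if the only pair $x',x''\in X$ with $x=\frac12(x'+x'')$ is $x'=x''=x$. -}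

module Defs where

open import Algebra.Bundles using (module CommutativeMonoid)
open import Algebra.Properties.CommutativeSemigroup using (interchange)
open import Data.Nat using (ℕ; zero; suc)
open import Data.Nat.Properties using (m≤m⊔n; m≤n⊔m)
open import Data.Product using (Σ-syntax; ∃-syntax; _×_; _,_; proj₁; proj₂)
open import Data.Rational using (ℚ; 0ℚ; 1ℚ)
open import Data.Sum using (_⊎_)
open import Function.Bundles using (_⇔_)
open import Function.Metric.Structures using (IsGeneralMetric)
open import Level using (0ℓ; Level) renaming (suc to lsuc)
open import Relation.Binary.Bundles using (Setoid)
open import Relation.Binary.PropositionalEquality using (_≡_; _≢_; refl; sym; trans; cong; cong₂; subst; module ≡-Reasoning)
open import Relation.Nullary using (¬_)
open import Relation.Unary using (Pred; _∈_; _⊆_; _≐_; _∩_; _∖_; _⊥_; _⟨×⟩_; ∁; ⋃; U)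

import Data.Nat as ℕ
import Data.Nat.Properties as ℕₚ
import Data.Rational as ℚ
import Data.Rational.Properties as ℚₚ

1ℓ 2ℓ : Level
1ℓ = lsuc 0ℓ
2ℓ = lsuc 1ℓ

-- Real numbers are Cauchy sequences of rationals, compared by _≈_.

Eventually : (ℕ → Set) → Set
Eventually P = ∃[ N ] (∀ n → N ℕ.≤ n → P n)

IsCauchy : (ℕ → ℚ) → Set
IsCauchy x = ∀ ε → 0ℚ ℚ.< ε → ∃[ N ] (∀ m n → N ℕ.≤ m → N ℕ.≤ n → ℚ.∣ x m ℚ.- x n ∣ ℚ.< ε)

record ℝ : Set where
  constructor mkℝ
  field
    seq    : ℕ → ℚ
    cauchy : IsCauchy seq

open ℝ public

infix 4 _≤_ _<_ _≈_

_≤_ : ℝ → ℝ → Set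
x ≤ y = ∀ ε → 0ℚ ℚ.< ε → Eventually (λ n → seq x n ℚ.≤ seq y n ℚ.+ ε)

_<_ : ℝ → ℝ → Set
x < y = ∃[ ε ] (0ℚ ℚ.< ε × Eventually (λ n → seq x n ℚ.+ ε ℚ.≤ seq y n))

_≈_ : ℝ → ℝ → Set
x ≈ y = x ≤ y × y ≤ x

private
  half-pos : ∀ {ε} → 0ℚ ℚ.< ε → 0ℚ ℚ.< ℚ.½ ℚ.* ε
  half-pos {ε} ε>0 = subst (ℚ._< ℚ.½ ℚ.* ε) (ℚₚ.*-zeroʳ ℚ.½) (ℚₚ.*-monoʳ-<-pos ℚ.½ ε>0)

  half+half : ∀ ε → ℚ.½ ℚ.* ε ℚ.+ ℚ.½ ℚ.* ε ≡ ε
  half+half ε = trans (sym (ℚₚ.*-distribʳ-+ ε ℚ.½ ℚ.½)) (ℚₚ.*-identityˡ ε)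

  cancel : ∀ a b → (a ℚ.- b) ℚ.+ b ≡ a
  cancel a b = trans (ℚₚ.+-assoc a (ℚ.- b) b)
                     (trans (cong (a ℚ.+_) (ℚₚ.+-inverseˡ b)) (ℚₚ.+-identityʳ a))

  *-distribˡ-- : ∀ a b c → a ℚ.* (b ℚ.- c) ≡ a ℚ.* b ℚ.- a ℚ.* c
  *-distribˡ-- a b c = trans (ℚₚ.*-distribˡ-+ a b (ℚ.- c))
                             (cong (a ℚ.* b ℚ.+_) (sym (ℚₚ.neg-distribʳ-* a c)))

  *-regroup : ∀ a b c d → a ℚ.* (b ℚ.- d) ℚ.+ d ℚ.* (a ℚ.- c) ≡ a ℚ.* b ℚ.- c ℚ.* d
  *-regroup a b c d = begin
      a ℚ.* (b ℚ.- d) ℚ.+ d ℚ.* (a ℚ.- c)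
    ≡⟨ cong₂ ℚ._+_ (*-distribˡ-- a b d) (*-distribˡ-- d a c) ⟩
      (a ℚ.* b ℚ.- a ℚ.* d) ℚ.+ (d ℚ.* a ℚ.- d ℚ.* c)
    ≡⟨ cong₂ (λ p q → (a ℚ.* b ℚ.- a ℚ.* d) ℚ.+ (p ℚ.- q)) (ℚₚ.*-comm d a) (ℚₚ.*-comm d c) ⟩
      (a ℚ.* b ℚ.- a ℚ.* d) ℚ.+ (a ℚ.* d ℚ.- c ℚ.* d)
    ≡⟨ sym (ℚₚ.+-assoc (a ℚ.* b ℚ.- a ℚ.* d) (a ℚ.* d) (ℚ.- (c ℚ.* d))) ⟩
      (a ℚ.* b ℚ.- a ℚ.* d) ℚ.+ a ℚ.* d ℚ.- c ℚ.* d
    ≡⟨ cong (ℚ._- c ℚ.* d) (cancel (a ℚ.* b) (a ℚ.* d)) ⟩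
      a ℚ.* b ℚ.- c ℚ.* d ∎
    where open ≡-Reasoning

  const-cauchy : ∀ q → IsCauchy (λ _ → q)
  const-cauchy q ε ε>0 = 0 , λ _ _ _ _ →
    subst (ℚ._< ε) (sym (cong ℚ.∣_∣ (ℚₚ.+-inverseʳ q))) ε>0

  +-cauchy : ∀ x y → IsCauchy x → IsCauchy y → IsCauchy (λ n → x n ℚ.+ y n)
  +-cauchy x y cx cy ε ε>0 with cx _ (half-pos ε>0) | cy _ (half-pos ε>0)
  ... | M , p | N , q = M ℕ.⊔ N , λ m n m≥ n≥ → begin-strict
      ℚ.∣ (x m ℚ.+ y m) ℚ.- (x n ℚ.+ y n) ∣
    ≡⟨ cong ℚ.∣_∣ (regroup (x m) (y m) (x n) (y n)) ⟩
      ℚ.∣ (x m ℚ.- x n) ℚ.+ (y m ℚ.- y n) ∣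
    ≤⟨ ℚₚ.∣p+q∣≤∣p∣+∣q∣ (x m ℚ.- x n) (y m ℚ.- y n) ⟩
      ℚ.∣ x m ℚ.- x n ∣ ℚ.+ ℚ.∣ y m ℚ.- y n ∣
    <⟨ ℚₚ.+-mono-< (p m n (ℕₚ.≤-trans (m≤m⊔n M N) m≥) (ℕₚ.≤-trans (m≤m⊔n M N) n≥))
                   (q m n (ℕₚ.≤-trans (m≤n⊔m M N) m≥) (ℕₚ.≤-trans (m≤n⊔m M N) n≥)) ⟩
      ℚ.½ ℚ.* ε ℚ.+ ℚ.½ ℚ.* ε
    ≡⟨ half+half ε ⟩
      ε ∎
    where
    open ℚₚ.≤-Reasoning
    regroup : ∀ a b c d → (a ℚ.+ b) ℚ.- (c ℚ.+ d) ≡ (a ℚ.- c) ℚ.+ (b ℚ.- d)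
    regroup a b c d = trans (cong (a ℚ.+ b ℚ.+_) (ℚₚ.neg-distrib-+ c d))
                            (interchange (CommutativeMonoid.commutativeSemigroup ℚₚ.+-0-commutativeMonoid)
                                         a b (ℚ.- c) (ℚ.- d))

  neg-cauchy : ∀ x → IsCauchy x → IsCauchy (λ n → ℚ.- x n)
  neg-cauchy x cx ε ε>0 with cx ε ε>0
  ... | N , p = N , λ m n m≥ n≥ →
    subst (ℚ._< ε)
      (trans (sym (ℚₚ.∣-p∣≡∣p∣ (x m ℚ.- x n)))
             (cong ℚ.∣_∣ (ℚₚ.neg-distrib-+ (x m) (ℚ.- x n))))
      (p m n m≥ n≥)

  eventually-bounded : ∀ x → IsCauchy x →
    ∃[ B ] (0ℚ ℚ.< B × Eventually (λ n → ℚ.∣ x n ∣ ℚ.≤ B))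
  eventually-bounded x cx with cx 1ℚ (ℚₚ.positive⁻¹ 1ℚ)
  ... | N , p = 1ℚ ℚ.+ ℚ.∣ x N ∣
              , ℚₚ.+-mono-<-≤ (ℚₚ.positive⁻¹ 1ℚ) (ℚₚ.0≤∣p∣ (x N))
              , N , λ n n≥ → begin
      ℚ.∣ x n ∣
    ≡⟨ cong ℚ.∣_∣ (cancel (x n) (x N)) ⟨
      ℚ.∣ (x n ℚ.- x N) ℚ.+ x N ∣
    ≤⟨ ℚₚ.∣p+q∣≤∣p∣+∣q∣ (x n ℚ.- x N) (x N) ⟩
      ℚ.∣ x n ℚ.- x N ∣ ℚ.+ ℚ.∣ x N ∣
    ≤⟨ ℚₚ.+-monoˡ-≤ ℚ.∣ x N ∣ (ℚₚ.<⇒≤ (p n N n≥ ℕₚ.≤-refl)) ⟩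
      1ℚ ℚ.+ ℚ.∣ x N ∣ ∎
    where
    open ℚₚ.≤-Reasoning

  scale-down : ∀ {B ε} → 0ℚ ℚ.< B → 0ℚ ℚ.< ε → ∃[ δ ] (0ℚ ℚ.< δ × B ℚ.* δ ≡ ε)
  scale-down {B} {ε} B>0 ε>0 = δ , δ>0 , Bδ≡ε
    where
    instance
      B⁺ : ℚ.Positive B
      B⁺ = ℚ.positive B>0
      B≠0 : ℚ.NonZero B
      B≠0 = ℚₚ.pos⇒nonZero B
      B⁻¹⁺ : ℚ.Positive (ℚ.1/ B)
      B⁻¹⁺ = ℚₚ.1/pos⇒pos B
    δ = ℚ.1/ B ℚ.* ε
    δ>0 : 0ℚ ℚ.< δ
    δ>0 = subst (ℚ._< δ) (ℚₚ.*-zeroʳ (ℚ.1/ B)) (ℚₚ.*-monoʳ-<-pos (ℚ.1/ B) ε>0)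
    Bδ≡ε : B ℚ.* δ ≡ ε
    Bδ≡ε = trans (sym (ℚₚ.*-assoc B (ℚ.1/ B) ε))
                 (trans (cong (ℚ._* ε) (ℚₚ.*-inverseʳ B)) (ℚₚ.*-identityˡ ε))

  *-close : ∀ {B δ p q} → 0ℚ ℚ.< B → ℚ.∣ p ∣ ℚ.≤ B → ℚ.∣ q ∣ ℚ.< δ → ℚ.∣ p ℚ.* q ∣ ℚ.< B ℚ.* δ
  *-close {B} {δ} {p} {q} B>0 p≤B q<δ = begin-strict
      ℚ.∣ p ℚ.* q ∣
    ≡⟨ ℚₚ.∣p*q∣≡∣p∣*∣q∣ p q ⟩
      ℚ.∣ p ∣ ℚ.* ℚ.∣ q ∣
    ≤⟨ ℚₚ.*-monoʳ-≤-nonNeg ℚ.∣ q ∣ p≤B ⟩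
      B ℚ.* ℚ.∣ q ∣
    <⟨ ℚₚ.*-monoʳ-<-pos B q<δ ⟩
      B ℚ.* δ ∎
    where
    open ℚₚ.≤-Reasoning
    instance
      B⁺ : ℚ.Positive B
      B⁺ = ℚ.positive B>0
      ∣q∣≥0 : ℚ.NonNegative ℚ.∣ q ∣
      ∣q∣≥0 = ℚₚ.∣-∣-nonNeg q

  *-cauchy-from : ∀ (x y : ℕ → ℚ) {ε A B δ η} →
    0ℚ ℚ.< A → ∀ K → (∀ n → K ℕ.≤ n → ℚ.∣ x n ∣ ℚ.≤ A) → A ℚ.* δ ≡ ℚ.½ ℚ.* ε →
    0ℚ ℚ.< B → ∀ L → (∀ n → L ℕ.≤ n → ℚ.∣ y n ∣ ℚ.≤ B) → B ℚ.* η ≡ ℚ.½ ℚ.* ε →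
    ∀ M → (∀ m n → M ℕ.≤ m → M ℕ.≤ n → ℚ.∣ y m ℚ.- y n ∣ ℚ.< δ) →
    ∀ N → (∀ m n → N ℕ.≤ m → N ℕ.≤ n → ℚ.∣ x m ℚ.- x n ∣ ℚ.< η) →
    ∃[ R ] (∀ m n → R ℕ.≤ m → R ℕ.≤ n → ℚ.∣ x m ℚ.* y m ℚ.- x n ℚ.* y n ∣ ℚ.< ε)
  *-cauchy-from x y {ε} {A} {B} {δ} {η} A>0 K a Aδ≡ B>0 L b Bη≡ M q N p =
    (K ℕ.⊔ L) ℕ.⊔ (M ℕ.⊔ N) , λ m n m≥ n≥ → begin-strict
      ℚ.∣ x m ℚ.* y m ℚ.- x n ℚ.* y n ∣
    ≡⟨ cong ℚ.∣_∣ (*-regroup (x m) (y m) (x n) (y n)) ⟨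
      ℚ.∣ x m ℚ.* (y m ℚ.- y n) ℚ.+ y n ℚ.* (x m ℚ.- x n) ∣
    ≤⟨ ℚₚ.∣p+q∣≤∣p∣+∣q∣ (x m ℚ.* (y m ℚ.- y n)) (y n ℚ.* (x m ℚ.- x n)) ⟩
      ℚ.∣ x m ℚ.* (y m ℚ.- y n) ∣ ℚ.+ ℚ.∣ y n ℚ.* (x m ℚ.- x n) ∣
    <⟨ ℚₚ.+-mono-< (*-close {p = x m} {y m ℚ.- y n} A>0 (a m (≥K m≥)) (q m n (≥M m≥) (≥M n≥)))
                   (*-close {p = y n} {x m ℚ.- x n} B>0 (b n (≥L n≥)) (p m n (≥N m≥) (≥N n≥))) ⟩
      A ℚ.* δ ℚ.+ B ℚ.* η
    ≡⟨ cong₂ ℚ._+_ Aδ≡ Bη≡ ⟩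
      ℚ.½ ℚ.* ε ℚ.+ ℚ.½ ℚ.* ε
    ≡⟨ half+half ε ⟩
      ε ∎
    where
    open ℚₚ.≤-Reasoning
    ≥KL : ∀ {m} → (K ℕ.⊔ L) ℕ.⊔ (M ℕ.⊔ N) ℕ.≤ m → K ℕ.⊔ L ℕ.≤ m
    ≥KL = ℕₚ.≤-trans (m≤m⊔n (K ℕ.⊔ L) (M ℕ.⊔ N))
    ≥MN : ∀ {m} → (K ℕ.⊔ L) ℕ.⊔ (M ℕ.⊔ N) ℕ.≤ m → M ℕ.⊔ N ℕ.≤ m
    ≥MN = ℕₚ.≤-trans (m≤n⊔m (K ℕ.⊔ L) (M ℕ.⊔ N))
    ≥K : ∀ {m} → (K ℕ.⊔ L) ℕ.⊔ (M ℕ.⊔ N) ℕ.≤ m → K ℕ.≤ m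
    ≥K h = ℕₚ.≤-trans (m≤m⊔n K L) (≥KL h)
    ≥L : ∀ {m} → (K ℕ.⊔ L) ℕ.⊔ (M ℕ.⊔ N) ℕ.≤ m → L ℕ.≤ m
    ≥L h = ℕₚ.≤-trans (m≤n⊔m K L) (≥KL h)
    ≥M : ∀ {m} → (K ℕ.⊔ L) ℕ.⊔ (M ℕ.⊔ N) ℕ.≤ m → M ℕ.≤ m
    ≥M h = ℕₚ.≤-trans (m≤m⊔n M N) (≥MN h)
    ≥N : ∀ {m} → (K ℕ.⊔ L) ℕ.⊔ (M ℕ.⊔ N) ℕ.≤ m → N ℕ.≤ m
    ≥N h = ℕₚ.≤-trans (m≤n⊔m M N) (≥MN h)

  *-cauchy : ∀ x y → IsCauchy x → IsCauchy y → IsCauchy (λ n → x n ℚ.* y n)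
  *-cauchy x y cx cy ε ε>0 =
    let A , A>0 , K , a = eventually-bounded x cx
        B , B>0 , L , b = eventually-bounded y cy
        δ , δ>0 , Aδ≡   = scale-down A>0 (half-pos ε>0)
        η , η>0 , Bη≡   = scale-down B>0 (half-pos ε>0)
        M , q           = cy δ δ>0
        N , p           = cx η η>0
    in *-cauchy-from x y A>0 K a Aδ≡ B>0 L b Bη≡ M q N p

infixl 6 _+_
infixl 7 _*_
infix  8 -_

fromℚ : ℚ → ℝ
fromℚ q = mkℝ (λ _ → q) (const-cauchy q)

0ℝ 1ℝ ½ : ℝ
0ℝ = fromℚ 0ℚ
1ℝ = fromℚ 1ℚ
½  = fromℚ ℚ.½

_+_ : ℝ → ℝ → ℝ
x + y = mkℝ (λ n → seq x n ℚ.+ seq y n) (+-cauchy (seq x) (seq y) (cauchy x) (cauchy y))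

-_ : ℝ → ℝ
- x = mkℝ (λ n → ℚ.- seq x n) (neg-cauchy (seq x) (cauchy x))

_*_ : ℝ → ℝ → ℝ
x * y = mkℝ (λ n → seq x n ℚ.* seq y n) (*-cauchy (seq x) (seq y) (cauchy x) (cauchy y))

partialSum : (ℕ → ℝ) → ℕ → ℝ
partialSum u zero    = 0ℝ
partialSum u (suc n) = partialSum u n + u n

_⟶_ : (ℕ → ℝ) → ℝ → Set
u ⟶ l = ∀ ε → 0ℝ < ε → Eventually (λ n → u n < l + ε × l < u n + ε)

record SigmaAlgebra (X : Set) : Set 2ℓ where
  field
    Measurable      : Pred (Pred X 0ℓ) 1ℓ
    measurable-resp : ∀ {A B} → A ≐ B → Measurable A → Measurable B
    measurable-U    : Measurable U
    measurable-∁    : ∀ {A} → Measurable A → Measurable (∁ A)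
    measurable-⋃    : ∀ (A : ℕ → Pred X 0ℓ) → (∀ n → Measurable (A n)) → Measurable (⋃ ℕ A)

open SigmaAlgebra public using (Measurable)

data Generated {X : Set} (G : Pred (Pred X 0ℓ) 1ℓ) : Pred (Pred X 0ℓ) 1ℓ where
  generator : ∀ {A} → G A → Generated G A
  resp      : ∀ {A B} → A ≐ B → Generated G A → Generated G B
  whole     : Generated G U
  compl     : ∀ {A} → Generated G A → Generated G (∁ A)
  union     : ∀ (A : ℕ → Pred X 0ℓ) → (∀ n → Generated G (A n)) → Generated G (⋃ ℕ A)

σ : {X : Set} → Pred (Pred X 0ℓ) 1ℓ → SigmaAlgebra X
σ G = record
  { Measurable      = Generated G
  ; measurable-resp = resp
  ; measurable-U    = whole
  ; measurable-∁    = compl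
  ; measurable-⋃    = union
  }

infixr 7 _⊗_

_⊗_ : {X Y : Set} → SigmaAlgebra X → SigmaAlgebra Y → SigmaAlgebra (X × Y)
_⊗_ {X} {Y} F G = σ (λ S → Σ[ A ∈ Pred X 0ℓ ] Σ[ B ∈ Pred Y 0ℓ ]
                           (Measurable F A × Measurable G B × S ≐ (A ⟨×⟩ B)))

IsMeasurable : {X : Set} → SigmaAlgebra X → (X → ℝ) → Set 1ℓ
IsMeasurable F f = ∀ a → Measurable F (λ x → a < f x)

-- Points are compared by a setoid equality, so that spaces such as
-- [0,1], whose natural equality is _≈_, are covered.  Open sets of a
-- metric on the setoid respect this equality, hence so do all Borel sets
-- and all Borel functions; this need not be required separately.

module _ (Ω : Setoid 0ℓ 0ℓ) where
  open Setoid Ω using (Carrier) renaming (_≈_ to _≈Ω_)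

  record PolishMetric : Set where
    field
      d         : Carrier → Carrier → ℝ
      isMetric  : IsGeneralMetric _≈Ω_ _≈_ _≤_ 0ℝ _+_ d
      complete  : ∀ (s : ℕ → Carrier) →
                  (∀ ε → 0ℝ < ε → ∃[ N ] (∀ m n → N ℕ.≤ m → N ℕ.≤ n → d (s m) (s n) < ε)) →
                  ∃[ l ] (∀ ε → 0ℝ < ε → Eventually (λ n → d (s n) l < ε))
      separable : Σ[ s ∈ (ℕ → Carrier) ] (∀ x ε → 0ℝ < ε → ∃[ n ] (d x (s n) < ε))

    IsOpen : Pred Carrier 0ℓ → Set
    IsOpen O = ∀ x → x ∈ O → ∃[ ε ] (0ℝ < ε × (∀ y → d x y < ε → y ∈ O))

    borel : SigmaAlgebra Carrier
    borel = σ (λ O → Level.Lift 1ℓ (IsOpen O))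

  IsStandardBorel : SigmaAlgebra Carrier → Set 1ℓ
  IsStandardBorel F = Σ[ M ∈ PolishMetric ]
    (∀ A → Measurable F A ⇔ Measurable (PolishMetric.borel M) A)

record ProbabilityMeasure {X : Set} (F : SigmaAlgebra X) : Set 1ℓ where
  field
    μ          : (A : Pred X 0ℓ) → Measurable F A → ℝ
    μ-cong     : ∀ {A B} (a : Measurable F A) (b : Measurable F B) → A ≐ B → μ A a ≈ μ B b
    μ-nonneg   : ∀ {A} (a : Measurable F A) → 0ℝ ≤ μ A a
    μ-total    : ∀ (u : Measurable F U) → μ U u ≈ 1ℝ
    μ-additive : ∀ (A : ℕ → Pred X 0ℓ) (a : ∀ n → Measurable F (A n))
                 (u : Measurable F (⋃ ℕ A)) →
                 (∀ m n → m ≢ n → A m ⊥ A n) →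
                 partialSum (λ n → μ (A n) (a n)) ⟶ μ (⋃ ℕ A) u

open ProbabilityMeasure public using (μ)

module _ {X : Set} {F : SigmaAlgebra X} (ν : ProbabilityMeasure F) where

  -- Contained in a measurable set of measure 0; for measurable S this
  -- says exactly that S has measure 0.
  Null : Pred X 0ℓ → Set 1ℓ
  Null S = Σ[ N ∈ Pred X 0ℓ ] Σ[ m ∈ Measurable F N ] (S ⊆ N × μ ν N m ≈ 0ℝ)

  AlmostEverywhere : Pred X 0ℓ → Set 1ℓ
  AlmostEverywhere P = Null (∁ P)

  Atomless : Set 1ℓ
  Atomless = ∀ A (a : Measurable F A) → 0ℝ < μ ν A a →
    Σ[ B ∈ Pred X 0ℓ ] Σ[ b ∈ Measurable F B ]
      (B ⊆ A × 0ℝ < μ ν B b × μ ν B b < μ ν A a)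

-- The product measure exists and, by the π-λ theorem, is determined by
-- its values on rectangles.
IsProductMeasure : {X Y : Set} {F : SigmaAlgebra X} {G : SigmaAlgebra Y} →
  ProbabilityMeasure F → ProbabilityMeasure G → ProbabilityMeasure (F ⊗ G) → Set 1ℓ
IsProductMeasure {F = F} {G} ν κ π =
  ∀ A B (a : Measurable F A) (b : Measurable G B) (r : Measurable (F ⊗ G) (A ⟨×⟩ B)) →
  μ π (A ⟨×⟩ B) r ≈ μ ν A a * μ κ B b

-- Elements of L∞ are given by representatives; see _=ᵃᵉ_ for their equality.

record L∞ {X : Set} {F : SigmaAlgebra X} (ν : ProbabilityMeasure F) : Set 1ℓ where
  field
    fun        : X → ℝ
    measurable : IsMeasurable F fun
    essBounded : Σ[ M ∈ ℝ ] AlmostEverywhere ν (λ x → - M ≤ fun x × fun x ≤ M)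

open L∞ public using (fun)

module _ {X : Set} {F : SigmaAlgebra X} (ν : ProbabilityMeasure F) where

  _=ᵃᵉ_ : (X → ℝ) → (X → ℝ) → Set 1ℓ
  f =ᵃᵉ g = AlmostEverywhere ν (λ x → f x ≈ g x)

  IsExtremePoint : Pred (L∞ ν) 1ℓ → L∞ ν → Set 1ℓ
  IsExtremePoint K c = c ∈ K × (∀ c′ c″ → c′ ∈ K → c″ ∈ K →
    fun c =ᵃᵉ (λ x → ½ * (fun c′ x + fun c″ x)) →
    fun c′ =ᵃᵉ fun c × fun c″ =ᵃᵉ fun c)

record Graphon {X : Set} (F : SigmaAlgebra X) : Set 1ℓ where
  field
    W          : X × X → ℝ
    measurable : IsMeasurable (F ⊗ F) W
    symmetric  : ∀ x y → W (x , y) ≈ W (y , x)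
    bounded    : ∀ p → 0ℝ ≤ W p × W p ≤ 1ℝ

  supp : Pred (X × X) 0ℓ
  supp p = 0ℝ < W p

module _ {X : Set} {F : SigmaAlgebra X} (ν² : ProbabilityMeasure (F ⊗ F)) (G : Graphon F) where
  open Graphon G

  VanishesOn : Pred X 0ℓ → Set 1ℓ
  VanishesOn A = Null ν² ((A ⟨×⟩ A) ∖ (λ p → W p ≈ 0ℝ))

  IsBipartite : Set 1ℓ
  IsBipartite = Σ[ Ω₁ ∈ Pred X 0ℓ ] Σ[ Ω₂ ∈ Pred X 0ℓ ]
    ( Measurable F Ω₁ × Measurable F Ω₂
    × (∀ x → x ∈ Ω₁ ⊎ x ∈ Ω₂) × Ω₁ ⊥ Ω₂
    × VanishesOn Ω₁ × VanishesOn Ω₂ )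

  FCOV : (ν : ProbabilityMeasure F) → Pred (L∞ ν) 1ℓ
  FCOV ν c =
      AlmostEverywhere ν (λ x → 0ℝ ≤ fun c x × fun c x ≤ 1ℝ)
    × Null ν² (supp ∖ (λ (x , y) → 1ℝ ≤ fun c x + fun c y))

{-# OPTIONS --safe #-}
module Submission where

-- With p t = min (2t) 1 (rise) and q t = max (2t - 1) 0 (fall) one has
-- t = ½ (p t + q t), and 1 ≤ a + b implies 1 ≤ p a + q b.  Hence, if Ω₁ ⊔ Ω₂ is the bipartition,
-- a cover c is the midpoint of the cover equal to p ∘ c on Ω₁ and to q ∘ c
-- on Ω₂ and of the cover with p and q exchanged.  When c is extreme the first
-- of these equals c almost everywhere, and a fixed point of p or of q in
-- [0,1] is 0 or 1.

open import Defs
open import Axiom.ExcludedMiddle using (ExcludedMiddle)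
open import Data.Bool using (if_then_else_)
open import Data.Empty using (⊥-elim)
open import Data.Nat using (ℕ; zero; suc)
open import Data.Product using (_×_; _,_; proj₁; proj₂)
open import Data.Rational using (ℚ; 0ℚ; 1ℚ)
open import Data.Rational.Solver using (module +-*-Solver)
open import Data.Sum using (_⊎_; inj₁; inj₂)
open import Level using (0ℓ)
open import Relation.Binary.Bundles using (Setoid)
open import Relation.Binary.PropositionalEquality using (_≡_; _≢_; refl; sym; cong; subst)
open import Relation.Nullary using (¬_; does; yes; no)
open import Relation.Unary using (Pred; _∈_; _⊆_; _≐_; _∩_; _∪_; _∖_; _⊥_; _⟨×⟩_; ∁; ⋃; ∅)
open import Relation.Unary.Properties using (≐-sym)

import Data.Nat as ℕ
import Data.Nat.Properties as ℕₚ
import Data.Rational as ℚ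
import Data.Rational.Properties as ℚₚ

open +-*-Solver using (solve; con; _:=_; _:+_; _:*_; _:-_; :-_)

-- Rational numbers

-- The identity is s − r = q − p, with sides moved so that the ring solver applies.
≤-by : ∀ {p q r s} → p ℚ.≤ q → r ℚ.+ q ≡ s ℚ.+ p → r ℚ.≤ s
≤-by {p} {q} {r} {s} p≤q eq = begin
    r
  ≡⟨ solve 2 (λ r q → r := r :+ q :- q) refl r q ⟩
    r ℚ.+ q ℚ.- q
  ≡⟨ cong (ℚ._- q) eq ⟩
    s ℚ.+ p ℚ.- q
  ≤⟨ ℚₚ.+-monoˡ-≤ (ℚ.- q) (ℚₚ.+-monoʳ-≤ s p≤q) ⟩
    s ℚ.+ q ℚ.- q
  ≡⟨ solve 2 (λ s q → s :+ q :- q := s) refl s q ⟩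
    s ∎
  where
  open ℚₚ.≤-Reasoning

halve : ∀ {ε} → 0ℚ ℚ.< ε → 0ℚ ℚ.< ℚ.½ ℚ.* ε
halve {ε} ε>0 = subst (ℚ._< ℚ.½ ℚ.* ε) (ℚₚ.*-zeroʳ ℚ.½) (ℚₚ.*-monoʳ-<-pos ℚ.½ ε>0)

p≤∣p∣ : ∀ p → p ℚ.≤ ℚ.∣ p ∣
p≤∣p∣ p with ℚₚ.≤-total 0ℚ p
... | inj₁ 0≤p = ℚₚ.≤-reflexive (sym (ℚₚ.0≤p⇒∣p∣≡p 0≤p))
... | inj₂ p≤0 = ℚₚ.≤-trans p≤0 (ℚₚ.0≤∣p∣ p)

Eventually-zip : ∀ {P Q R : ℕ → Set} → (∀ n → P n → Q n → R n) →
  Eventually P → Eventually Q → Eventually R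
Eventually-zip f (M , p) (N , q) = M ℕ.⊔ N , λ n n≥ →
  f n (p n (ℕₚ.≤-trans (ℕₚ.m≤m⊔n M N) n≥)) (q n (ℕₚ.≤-trans (ℕₚ.m≤n⊔m M N) n≥))

-- The ordered group of real numbers

≡⇒≤ : ∀ x y → (∀ n → seq x n ≡ seq y n) → x ≤ y
≡⇒≤ x y eq ε ε>0 = 0 , λ n _ →
  ≤-by (ℚₚ.<⇒≤ ε>0) (subst (λ p → seq x n ℚ.+ ε ≡ p ℚ.+ ε ℚ.+ 0ℚ) (eq n)
    (sym (ℚₚ.+-identityʳ (seq x n ℚ.+ ε))))

≡⇒≈ : ∀ x y → (∀ n → seq x n ≡ seq y n) → x ≈ y
≡⇒≈ x y eq = ≡⇒≤ x y eq , ≡⇒≤ y x (λ n → sym (eq n))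

≤-refl : ∀ x → x ≤ x
≤-refl x = ≡⇒≤ x x (λ _ → refl)

≤-trans : ∀ x y z → x ≤ y → y ≤ z → x ≤ z
≤-trans x y z x≤y y≤z ε ε>0 = Eventually-zip
  (λ n a b → ≤-by (ℚₚ.+-mono-≤ a b)
    (solve 4 (λ x y z ε → x :+ (y :+ con ℚ.½ :* ε :+ (z :+ con ℚ.½ :* ε)) := z :+ ε :+ (x :+ y))
      refl (seq x n) (seq y n) (seq z n) ε))
  (x≤y _ (halve ε>0)) (y≤z _ (halve ε>0))

≈-trans : ∀ x y z → x ≈ y → y ≈ z → x ≈ z
≈-trans x y z (x≤y , y≤x) (y≤z , z≤y) = ≤-trans x y z x≤y y≤z , ≤-trans z y x z≤y y≤x

+-mono-≤ : ∀ x y u v → x ≤ y → u ≤ v → x + u ≤ y + v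
+-mono-≤ x y u v x≤y u≤v ε ε>0 = Eventually-zip
  (λ n a b → ≤-by (ℚₚ.+-mono-≤ a b)
    (solve 5 (λ x y u v ε → x :+ u :+ (y :+ con ℚ.½ :* ε :+ (v :+ con ℚ.½ :* ε))
                         := y :+ v :+ ε :+ (x :+ u))
      refl (seq x n) (seq y n) (seq u n) (seq v n) ε))
  (x≤y _ (halve ε>0)) (u≤v _ (halve ε>0))

-- The termwise identity says s - r = y - x; this is the counterpart of `≤-by` for reals, with the
-- same slack ε on both sides.
≤-rearrange : ∀ x y r s → x ≤ y →
  (∀ n → seq r n ℚ.+ seq y n ≡ seq s n ℚ.+ seq x n) → r ≤ s
≤-rearrange x y r s x≤y eq ε ε>0 with x≤y ε ε>0
... | N , p = N , λ n n≥ → ≤-by (p n n≥)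
  (subst (λ t → seq r n ℚ.+ (seq y n ℚ.+ ε) ≡ t) (shuffle (seq s n) (seq x n) ε)
    (subst (λ t → seq r n ℚ.+ (seq y n ℚ.+ ε) ≡ t ℚ.+ ε) (eq n)
      (sym (ℚₚ.+-assoc (seq r n) (seq y n) ε))))
  where
  shuffle : ∀ s x ε → s ℚ.+ x ℚ.+ ε ≡ s ℚ.+ ε ℚ.+ x
  shuffle = solve 3 (λ s x ε → s :+ x :+ ε := s :+ ε :+ x) refl

<⇒≤ : ∀ x y → x < y → x ≤ y
<⇒≤ x y (δ , δ>0 , N , p) ε ε>0 = N , λ n n≥ →
  ≤-by (ℚₚ.+-mono-≤ (p n n≥) (ℚₚ.+-mono-≤ (ℚₚ.<⇒≤ δ>0) (ℚₚ.<⇒≤ ε>0)))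
    (solve 4 (λ x y δ ε → x :+ (y :+ (δ :+ ε)) := y :+ ε :+ (x :+ δ :+ (con 0ℚ :+ con 0ℚ)))
      refl (seq x n) (seq y n) δ ε)

-- Half of the gap δ pays for the error allowed in `y ≤ z`; the other half remains as the new gap.
<-≤-trans : ∀ x y z → x < y → y ≤ z → x < z
<-≤-trans x y z (δ , δ>0 , x<y) y≤z = ℚ.½ ℚ.* δ , halve δ>0 , Eventually-zip
  (λ n a b → ≤-by (ℚₚ.+-mono-≤ a b)
    (solve 4 (λ x y z δ → x :+ con ℚ.½ :* δ :+ (y :+ (z :+ con ℚ.½ :* δ)) := z :+ (x :+ δ :+ y))
      refl (seq x n) (seq y n) (seq z n) δ))
  x<y (y≤z _ (halve δ>0))

≤-<-trans : ∀ x y z → x ≤ y → y < z → x < z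
≤-<-trans x y z x≤y (δ , δ>0 , y<z) = ℚ.½ ℚ.* δ , halve δ>0 , Eventually-zip
  (λ n a b → ≤-by (ℚₚ.+-mono-≤ a b)
    (solve 4 (λ x y z δ → x :+ con ℚ.½ :* δ :+ (y :+ con ℚ.½ :* δ :+ z) := z :+ (x :+ (y :+ δ)))
      refl (seq x n) (seq y n) (seq z n) δ))
  (x≤y _ (halve δ>0)) y<z

+-mono-< : ∀ x y u v → x < y → u < v → x + u < y + v
+-mono-< x y u v (δ , δ>0 , x<y) (η , η>0 , u<v) =
  δ ℚ.+ η , ℚₚ.+-mono-< δ>0 η>0 , Eventually-zip
  (λ n a b → ≤-by (ℚₚ.+-mono-≤ a b)
    (solve 6 (λ x y u v δ η → x :+ u :+ (δ :+ η) :+ (y :+ v) := y :+ v :+ (x :+ δ :+ (u :+ η)))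
      refl (seq x n) (seq y n) (seq u n) (seq v n) δ η))
  x<y u<v

<⇒≱ : ∀ x y → x < y → ¬ (y ≤ x)
<⇒≱ x y x<y y≤x = irrefl (<-≤-trans x y x x<y y≤x)
  where
  x+δ≤x⇒δ≤0 : ∀ p δ → p ℚ.+ δ ℚ.≤ p → δ ℚ.≤ 0ℚ
  x+δ≤x⇒δ≤0 p δ h = ≤-by h (solve 2 (λ p δ → δ :+ p := con 0ℚ :+ (p :+ δ)) refl p δ)
  irrefl : ¬ (x < x)
  irrefl (δ , δ>0 , N , h) =
    ℚₚ.<-irrefl {0ℚ} refl (ℚₚ.<-≤-trans δ>0 (x+δ≤x⇒δ≤0 (seq x N) δ (h N ℕₚ.≤-refl)))

-- With δ = ε/4, take an index N after which z = y - x varies by less than δ, and compare the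
-- rational z_N with 2δ. If z_N exceeds 2δ, then z stays above δ from N on, so that `x < y`.
≮⇒≥ : ∀ x y → ¬ (x < y) → y ≤ x
≮⇒≥ x y x≮y ε ε>0 = compare (cauchy z δ δ>0)
  where
  z : ℝ
  z = y + - x
  δ = ℚ.½ ℚ.* (ℚ.½ ℚ.* ε)
  δ>0 : 0ℚ ℚ.< δ
  δ>0 = halve (halve ε>0)
  compare : _ → Eventually (λ n → seq y n ℚ.≤ seq x n ℚ.+ ε)
  compare (N , close) with seq z N ℚₚ.≤? (δ ℚ.+ δ)
  ... | yes zN≤2δ = N , λ n n≥ →
    -- Here z stays below 3δ; the summand 0 ≤ δ pads the bound to 4δ = ε.
    ≤-by (ℚₚ.+-mono-≤ (ℚₚ.+-mono-≤ zN≤2δ (ℚₚ.<⇒≤ δ>0))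
                      (ℚₚ.≤-trans (p≤∣p∣ (seq z n ℚ.- seq z N)) (ℚₚ.<⇒≤ (close n N n≥ ℕₚ.≤-refl))))
      (solve 4 (λ x y w ε → let δ = con ℚ.½ :* (con ℚ.½ :* ε) in
          y :+ (δ :+ δ :+ δ :+ δ) := x :+ ε :+ (w :+ con 0ℚ :+ (y :+ :- x :- w)))
        refl (seq x n) (seq y n) (seq z N) ε)
  ... | no zN≰2δ = ⊥-elim (x≮y (δ , δ>0 , N , λ n n≥ →
    ≤-by (ℚₚ.+-mono-≤ (ℚₚ.<⇒≤ (ℚₚ.≰⇒> zN≰2δ))
                      (ℚₚ.≤-trans (p≤∣p∣ (seq z N ℚ.- seq z n)) (ℚₚ.<⇒≤ (close N n ℕₚ.≤-refl n≥))))
      (solve 4 (λ x y w δ → x :+ δ :+ (w :+ δ) := y :+ (δ :+ δ :+ (w :- (y :+ :- x))))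
        refl (seq x n) (seq y n) (seq z N) δ)))

-- Limits of real sequences

≤-from-<+ε : ∀ x y → (∀ ε → 0ℝ < ε → x < y + ε) → x ≤ y
≤-from-<+ε x y h ε ε>0 with h (fromℚ ε) (ε , ε>0 , 0 , λ _ _ → ℚₚ.≤-reflexive (ℚₚ.+-identityˡ ε))
... | δ , δ>0 , N , p = N , λ n n≥ →
  ≤-by (ℚₚ.+-mono-≤ (p n n≥) (ℚₚ.<⇒≤ δ>0))
    (solve 4 (λ x y ε δ → x :+ (y :+ ε :+ δ) := y :+ ε :+ (x :+ δ :+ con 0ℚ))
      refl (seq x n) (seq y n) ε δ)

-- The index k + N lies past both the start k of the bound and the threshold N of convergence. The
-- offset k serves partial sums that are controlled only after their first terms.
limit-≥ : ∀ u l x k → u ⟶ l → (∀ n → x ≤ u (k ℕ.+ n)) → x ≤ l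
limit-≥ u l x k u⟶l x≤u = ≤-from-<+ε x l λ ε ε>0 →
  let N , p = u⟶l ε ε>0
  in ≤-<-trans x (u (k ℕ.+ N)) (l + ε) (x≤u N) (proj₁ (p (k ℕ.+ N) (ℕₚ.m≤n+m N k)))

limit-≤ : ∀ u l x k → u ⟶ l → (∀ n → u (k ℕ.+ n) ≤ x) → l ≤ x
limit-≤ u l x k u⟶l u≤x = ≤-from-<+ε l x λ ε ε>0 →
  let N , p = u⟶l ε ε>0
  in <-≤-trans l (u (k ℕ.+ N) + ε) (x + ε) (proj₂ (p (k ℕ.+ N) (ℕₚ.m≤n+m N k)))
       (+-mono-≤ (u (k ℕ.+ N)) x ε ε (u≤x N) (≤-refl ε))

-- Inequalities under doubling and translation

double : ∀ x → ½ * x + ½ * x ≈ x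
double x = ≡⇒≈ (½ * x + ½ * x) x λ n →
  solve 1 (λ x → con ℚ.½ :* x :+ con ℚ.½ :* x := x) refl (seq x n)

-- With its converse below, this turns the superlevel set of 2f at a into that of f at a/2, which
-- gives measurability of 2f.
<½⇒<double : ∀ a x → ½ * a < x → a < x + x
<½⇒<double a x h = ≤-<-trans a (½ * a + ½ * a) (x + x) (proj₂ (double a))
  (+-mono-< (½ * a) x (½ * a) x h h)

<double⇒<½ : ∀ a x → a < x + x → ½ * a < x
<double⇒<½ a x (δ , δ>0 , N , p) = ℚ.½ ℚ.* δ , halve δ>0 , N , λ n n≥ →
  ≤-by (ℚₚ.*-monoˡ-≤-nonNeg ℚ.½ (p n n≥))
    (solve 3 (λ a x δ → con ℚ.½ :* a :+ con ℚ.½ :* δ :+ con ℚ.½ :* (x :+ x)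
                     := x :+ con ℚ.½ :* (a :+ δ)) refl (seq a n) (seq x n) δ)

<-moveˡ : ∀ a x b → a + b < x → a < x + - b
<-moveˡ a x b (δ , δ>0 , N , p) = δ , δ>0 , N , λ n n≥ → ≤-by (p n n≥)
  (solve 4 (λ a x b δ → a :+ δ :+ x := x :+ :- b :+ (a :+ b :+ δ)) refl (seq a n) (seq x n) (seq b n) δ)

<-moveʳ : ∀ a x b → a < x + - b → a + b < x
<-moveʳ a x b (δ , δ>0 , N , p) = δ , δ>0 , N , λ n n≥ → ≤-by (p n n≥)
  (solve 4 (λ a x b δ → a :+ b :+ δ :+ (x :+ :- b) := x :+ (a :+ δ)) refl (seq a n) (seq x n) (seq b n) δ)

0≤1 : 0ℝ ≤ 1ℝ
0≤1 ε ε>0 = 0 , λ _ _ → ℚₚ.+-mono-≤ (ℚₚ.<⇒≤ (ℚₚ.positive⁻¹ 1ℚ)) (ℚₚ.<⇒≤ ε>0)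

½+½≈1 : ½ + ½ ≈ 1ℝ
½+½≈1 = ≡⇒≈ (½ + ½) 1ℝ (λ _ → refl)

-- Measurable sets and functions

module _ {X : Set} (F : SigmaAlgebra X) where
  open SigmaAlgebra F using (measurable-resp; measurable-U; measurable-∁; measurable-⋃)

  measurable-∅ : Measurable F ∅
  measurable-∅ = measurable-resp ((λ ¬u → ¬u _) , λ ()) (measurable-∁ measurable-U)

  -- The axioms speak of sequences of sets only, so a binary union is a countable one padded with
  -- empty sets.
  pair : Pred X 0ℓ → Pred X 0ℓ → ℕ → Pred X 0ℓ
  pair A B 0             = A
  pair A B 1             = B
  pair A B (suc (suc _)) = ∅

  ⋃-pair : ∀ A B → ⋃ ℕ (pair A B) ≐ A ∪ B
  ⋃-pair A B = to , from
    where
    to : ⋃ ℕ (pair A B) ⊆ A ∪ B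
    to (0 , x∈A) = inj₁ x∈A
    to (1 , x∈B) = inj₂ x∈B
    from : A ∪ B ⊆ ⋃ ℕ (pair A B)
    from (inj₁ x∈A) = 0 , x∈A
    from (inj₂ x∈B) = 1 , x∈B

  measurable-pair : ∀ {A B} → Measurable F A → Measurable F B → ∀ n → Measurable F (pair A B n)
  measurable-pair a b 0             = a
  measurable-pair a b 1             = b
  measurable-pair a b (suc (suc _)) = measurable-∅

  measurable-⋃-pair : ∀ {A B} → Measurable F A → Measurable F B → Measurable F (⋃ ℕ (pair A B))
  measurable-⋃-pair {A} {B} a b = measurable-⋃ (pair A B) (measurable-pair a b)

  measurable-∪ : ∀ {A B} → Measurable F A → Measurable F B → Measurable F (A ∪ B)
  measurable-∪ {A} {B} a b = measurable-resp (⋃-pair A B) (measurable-⋃-pair a b)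

-- Constructions by classical case distinction

module Classical (em : ExcludedMiddle 0ℓ) where

  piecewise : {X Y : Set} → Pred X 0ℓ → (X → Y) → (X → Y) → X → Y
  piecewise A f g x = if does (em {A x}) then f x else g x

  -- Both functions branch on the same test, so one case distinction determines both values
  -- together.
  piecewise-elim : {X Y : Set} (A : Pred X 0ℓ) (f g f′ g′ : X → Y) (P : Y → Y → Set) (x : X) →
    (x ∈ A → P (f x) (f′ x)) → (¬ (x ∈ A) → P (g x) (g′ x)) →
    P (piecewise A f g x) (piecewise A f′ g′ x)
  piecewise-elim A f g f′ g′ P x inside outside with em {A x}
  ... | yes x∈A = inside x∈A
  ... | no x∉A  = outside x∉A

  module _ {X : Set} (F : SigmaAlgebra X) where
    open SigmaAlgebra F using (measurable-resp; measurable-U; measurable-∁)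

    measurable-∩ : ∀ {A B} → Measurable F A → Measurable F B → Measurable F (A ∩ B)
    measurable-∩ {A} {B} a b = measurable-resp (to , from)
      (measurable-∁ (measurable-∪ F (measurable-∁ a) (measurable-∁ b)))
      where
      to : ∁ (∁ A ∪ ∁ B) ⊆ A ∩ B
      to {x} h with em {A x} | em {B x}
      ... | yes x∈A | yes x∈B = x∈A , x∈B
      ... | no x∉A  | _       = ⊥-elim (h (inj₁ x∉A))
      ... | _       | no x∉B  = ⊥-elim (h (inj₂ x∉B))
      from : A ∩ B ⊆ ∁ (∁ A ∪ ∁ B)
      from (x∈A , _) (inj₁ x∉A) = x∉A x∈A
      from (_ , x∈B) (inj₂ x∉B) = x∉B x∈B

    -- By excluded middle such a set is the whole space or empty; superlevel sets of constant
    -- functions have this form.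
    measurable-const : (P : Set) → Measurable F (λ _ → P)
    measurable-const P with em {P}
    ... | yes p = measurable-resp ((λ _ → p) , λ _ → _) measurable-U
    ... | no ¬p = measurable-resp ((λ ()) , ¬p) (measurable-∅ F)

    isMeasurable-const : ∀ r → IsMeasurable F (λ _ → r)
    isMeasurable-const r a = measurable-const (a < r)

    isMeasurable-double : ∀ {f} → IsMeasurable F f → IsMeasurable F (λ x → f x + f x)
    isMeasurable-double {f} m a = measurable-resp
      ((λ {x} → <½⇒<double a (f x)) , (λ {x} → <double⇒<½ a (f x))) (m (½ * a))

    isMeasurable-shift : ∀ {f} r → IsMeasurable F f → IsMeasurable F (λ x → f x + - r)
    isMeasurable-shift {f} r m a = measurable-resp
      ((λ {x} → <-moveˡ a (f x) r) , (λ {x} → <-moveʳ a (f x) r)) (m (a + r))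

    isMeasurable-piecewise : ∀ {A f g} → Measurable F A → IsMeasurable F f → IsMeasurable F g →
      IsMeasurable F (piecewise A f g)
    isMeasurable-piecewise {A} {f} {g} m mf mg a = measurable-resp (to , from)
      (measurable-∪ F (measurable-∩ m (mf a)) (measurable-∩ (measurable-∁ m) (mg a)))
      where
      to : (A ∩ λ x → a < f x) ∪ (∁ A ∩ λ x → a < g x) ⊆ λ x → a < piecewise A f g x
      to {x} h with em {A x} | h
      ... | yes _   | inj₁ (_ , a<f)   = a<f
      ... | yes x∈A | inj₂ (x∉A , _)   = ⊥-elim (x∉A x∈A)
      ... | no x∉A  | inj₁ (x∈A , _)   = ⊥-elim (x∉A x∈A)
      ... | no _    | inj₂ (_ , a<g)   = a<g
      from : (λ x → a < piecewise A f g x) ⊆ (A ∩ λ x → a < f x) ∪ (∁ A ∩ λ x → a < g x)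
      from {x} h with em {A x}
      ... | yes x∈A = inj₁ (x∈A , h)
      ... | no x∉A  = inj₂ (x∉A , h)

  -- Null sets

  -- The pieces on the left are disjoint, so additivity applies to them.
  ∖-split : {X : Set} (A B : Pred X 0ℓ) → B ∪ (A ∖ B) ≐ A ∪ B
  ∖-split A B = to , from
    where
    to : B ∪ (A ∖ B) ⊆ A ∪ B
    to (inj₁ x∈B)       = inj₂ x∈B
    to (inj₂ (x∈A , _)) = inj₁ x∈A
    from : A ∪ B ⊆ B ∪ (A ∖ B)
    from (inj₂ x∈B) = inj₁ x∈B
    from {x} (inj₁ x∈A) with em {B x}
    ... | yes x∈B = inj₁ x∈B
    ... | no x∉B  = inj₂ (x∈A , x∉B)

  module _ {X : Set} {F : SigmaAlgebra X} (ν : ProbabilityMeasure F) where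
    open SigmaAlgebra F using (measurable-∁)
    open ProbabilityMeasure ν using (μ-cong; μ-nonneg; μ-additive)

    -- The constant sequence ∅ is disjoint with union ∅, so the partial sums of the constant m tend
    -- to m. From index 2 on they are at least 2m, whence 2m ≤ m.
    μ-∅ : μ ν ∅ (measurable-∅ F) ≤ 0ℝ
    μ-∅ = ≤-rearrange (0ℝ + m + m) m m 0ℝ
      (≤-trans (0ℝ + m + m) m∪ m
        (limit-≥ (partialSum u) m∪ (0ℝ + m + m) 2
          (μ-additive _ (λ _ → measurable-∅ F) ∅∪ (λ _ _ _ ()))
          (λ n → +-mono-≤ (0ℝ + m) (partialSum u (suc n)) m m
            (+-mono-≤ 0ℝ (partialSum u n) m m (nonneg n) (≤-refl m)) (≤-refl m)))
        (proj₁ (μ-cong ∅∪ (measurable-∅ F) ((λ ()) , λ ()))))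
      (λ n → solve 1 (λ m → m :+ m := con 0ℚ :+ (con 0ℚ :+ m :+ m)) refl (seq m n))
      where
      m m∪ : ℝ
      u : ℕ → ℝ
      ∅∪ : Measurable F (⋃ ℕ (λ _ → ∅))
      m  = μ ν ∅ (measurable-∅ F)
      u  = λ _ → m
      ∅∪ = SigmaAlgebra.measurable-⋃ F (λ _ → ∅) (λ _ → measurable-∅ F)
      m∪ = μ ν _ ∅∪
      nonneg : ∀ n → 0ℝ ≤ partialSum u n
      nonneg zero    = ≤-refl 0ℝ
      nonneg (suc n) = ≤-rearrange (0ℝ + 0ℝ) (partialSum u n + m) 0ℝ (partialSum u n + m)
        (+-mono-≤ 0ℝ (partialSum u n) 0ℝ m (nonneg n) (μ-nonneg (measurable-∅ F)))
        (λ k → solve 1 (λ s → con 0ℚ :+ s := s :+ (con 0ℚ :+ con 0ℚ)) refl (seq (partialSum u n + m) k))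

    module _ {A B : Pred X 0ℓ} (a : Measurable F A) (b : Measurable F B) (A⊥B : A ⊥ B) where
      private
        α β s : ℝ
        α = μ ν A a
        β = μ ν B b
        s = μ ν _ (measurable-⋃-pair F a b)

        u S : ℕ → ℝ
        u n = μ ν _ (measurable-pair F a b n)
        S   = partialSum u

        disjoint : ∀ m n → m ≢ n → pair F A B m ⊥ pair F A B n
        disjoint 0 0 m≢n _ = m≢n refl
        disjoint 0 1 _ (x∈A , x∈B) = A⊥B (x∈A , x∈B)
        disjoint 1 0 _ (x∈B , x∈A) = A⊥B (x∈A , x∈B)
        disjoint 1 1 m≢n _ = m≢n refl
        disjoint 0 (suc (suc _)) _ (_ , ())
        disjoint 1 (suc (suc _)) _ (_ , ())
        disjoint (suc (suc _)) _ _ (() , _)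

        S⟶s : S ⟶ s
        S⟶s = μ-additive (pair F A B) (measurable-pair F a b) (measurable-⋃-pair F a b) disjoint

        unit : ∀ x → x + 0ℝ ≈ x
        unit x = ≡⇒≈ (x + 0ℝ) x (λ n → ℚₚ.+-identityʳ (seq x n))

        -- All terms from index 2 on are the measure of ∅, so the sums stop changing and their limit
        -- is α + β.
        S-constant : ∀ n → S (2 ℕ.+ n) ≈ α + β
        S-constant zero = ≡⇒≈ (S 2) (α + β) (λ n →
          solve 2 (λ x y → con 0ℚ :+ x :+ y := x :+ y) refl (seq α n) (seq β n))
        S-constant (suc n) with S-constant n
        ... | S≤ , ≤S =
            ≤-trans (S (3 ℕ.+ n)) (α + β + 0ℝ) (α + β)
              (+-mono-≤ (S (2 ℕ.+ n)) (α + β) (u (2 ℕ.+ n)) 0ℝ S≤ μ-∅) (proj₁ (unit (α + β)))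
          , ≤-trans (α + β) (α + β + 0ℝ) (S (3 ℕ.+ n)) (proj₂ (unit (α + β)))
              (+-mono-≤ (α + β) (S (2 ℕ.+ n)) 0ℝ (u (2 ℕ.+ n)) ≤S (μ-nonneg (measurable-∅ F)))

      μ-∪ : (c : Measurable F (A ∪ B)) → μ ν (A ∪ B) c ≈ μ ν A a + μ ν B b
      μ-∪ c = ≈-trans (μ ν _ c) s (α + β)
        (μ-cong c (measurable-⋃-pair F a b) (≐-sym (⋃-pair F A B)))
        ( limit-≤ S s (α + β) 2 S⟶s (λ n → proj₁ (S-constant n))
        , limit-≥ S s (α + β) 2 S⟶s (λ n → proj₂ (S-constant n)))

    -- Splitting a union into disjoint pieces yields both monotonicity and, in `null-∪`, the bound
    -- for two overlapping null sets.
    μ-∪-∖ : ∀ {A B} (a : Measurable F A) (b : Measurable F B)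
      (d : Measurable F (A ∖ B)) (e : Measurable F (A ∪ B)) →
      μ ν (A ∪ B) e ≈ μ ν B b + μ ν (A ∖ B) d
    μ-∪-∖ {A} {B} a b d e =
      ≈-trans (μ ν _ e) (μ ν _ e′) (μ ν B b + μ ν (A ∖ B) d)
        (μ-cong e e′ (≐-sym (∖-split A B)))
        (μ-∪ b d (λ (x∈B , _ , x∉B) → x∉B x∈B) e′)
      where
      e′ : Measurable F (B ∪ (A ∖ B))
      e′ = measurable-∪ F b d

    μ-mono : ∀ {A B} (a : Measurable F A) (b : Measurable F B) → B ⊆ A → μ ν B b ≤ μ ν A a
    μ-mono {A} {B} a b B⊆A =
      ≤-trans β (β + δ) α
        (≤-rearrange 0ℝ δ β (β + δ) (μ-nonneg d)
          (λ n → sym (ℚₚ.+-identityʳ (seq (β + δ) n))))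
        (≤-trans (β + δ) (μ ν _ e) α (proj₂ (μ-∪-∖ a b d e))
          (proj₁ (μ-cong e a ((λ { (inj₁ x∈A) → x∈A ; (inj₂ x∈B) → B⊆A x∈B }) , inj₁))))
      where
      d = measurable-∩ F a (measurable-∁ b)
      e = measurable-∪ F a b
      α = μ ν A a
      β = μ ν B b
      δ = μ ν (A ∖ B) d

    null-⊆ : ∀ {S T} → S ⊆ T → Null ν T → Null ν S
    null-⊆ S⊆T (N , m , T⊆N , N≈0) = N , m , (λ x∈S → T⊆N (S⊆T x∈S)) , N≈0

    null-∅ : Null ν ∅
    null-∅ = ∅ , measurable-∅ F , (λ ()) , μ-∅ , μ-nonneg (measurable-∅ F)

    null-∪ : ∀ {S T} → Null ν S → Null ν T → Null ν (S ∪ T)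
    null-∪ (M , m , S⊆M , M≤0 , _) (N , n , T⊆N , N≤0 , _) =
        M ∪ N , e , (λ { (inj₁ x∈S) → inj₁ (S⊆M x∈S) ; (inj₂ x∈T) → inj₂ (T⊆N x∈T) })
      , ≤-trans (μ ν _ e) (μ ν N n + μ ν _ d) 0ℝ (proj₁ (μ-∪-∖ m n d e))
          -- The resulting bound `0ℝ + 0ℝ` serves as `0ℝ`: the order looks only at the rational
          -- sequences, and 0 + 0 computes.
          (+-mono-≤ (μ ν N n) 0ℝ (μ ν _ d) 0ℝ N≤0
            (≤-trans (μ ν _ d) (μ ν M m) 0ℝ (μ-mono m d proj₁) M≤0))
      , μ-nonneg e
      where
      d = measurable-∩ F m (measurable-∁ n)
      e = measurable-∪ F m n

  -- The maps t ↦ min (2t) 1 and t ↦ max (2t - 1) 0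

  rise fall : ℝ → ℝ
  rise = piecewise (½ <_) (λ _ → 1ℝ) (λ t → t + t)
  fall = piecewise (½ <_) (λ t → t + t + - 1ℝ) (λ _ → 0ℝ)

  -- Both maps test ½ < t, so a single distinction fixes both values; a statement about one map lets
  -- P ignore the other argument.
  rise-fall-elim : (P : ℝ → ℝ → Set) → ∀ t →
    (½ < t → P 1ℝ (t + t + - 1ℝ)) → (t ≤ ½ → P (t + t) 0ℝ) → P (rise t) (fall t)
  rise-fall-elim P t above below =
    piecewise-elim (½ <_) (λ _ → 1ℝ) (λ t → t + t) (λ t → t + t + - 1ℝ) (λ _ → 0ℝ) P t
      above (λ ½≮t → below (≮⇒≥ ½ t ½≮t))

  rise-fall-average : ∀ t → t ≈ ½ * (rise t + fall t)
  rise-fall-average t = rise-fall-elim (λ r f → t ≈ ½ * (r + f)) t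
    (λ _ → ≡⇒≈ t (½ * (1ℝ + (t + t + - 1ℝ))) λ n →
      solve 1 (λ t → t := con ℚ.½ :* (con 1ℚ :+ (t :+ t :+ :- con 1ℚ))) refl (seq t n))
    (λ _ → ≡⇒≈ t (½ * (t + t + 0ℝ)) λ n →
      solve 1 (λ t → t := con ℚ.½ :* (t :+ t :+ con 0ℚ)) refl (seq t n))

  fall-rise-average : ∀ t → t ≈ ½ * (fall t + rise t)
  fall-rise-average t = ≈-trans t (½ * (rise t + fall t)) (½ * (fall t + rise t))
    (rise-fall-average t)
    (≡⇒≈ (½ * (rise t + fall t)) (½ * (fall t + rise t)) λ n →
      cong (ℚ.½ ℚ.*_) (ℚₚ.+-comm (seq (rise t) n) (seq (fall t) n)))

  double≥1 : ∀ t → ½ ≤ t → 1ℝ ≤ t + t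
  double≥1 t ½≤t = ≤-trans 1ℝ (½ + ½) (t + t) (proj₂ ½+½≈1) (+-mono-≤ ½ t ½ t ½≤t ½≤t)

  double≤1 : ∀ t → t ≤ ½ → t + t ≤ 1ℝ
  double≤1 t t≤½ = ≤-trans (t + t) (½ + ½) 1ℝ (+-mono-≤ t ½ t ½ t≤½ t≤½) (proj₁ ½+½≈1)

  fall≥0 : ∀ t → 0ℝ ≤ fall t
  fall≥0 t = rise-fall-elim (λ _ f → 0ℝ ≤ f) t
    (λ ½<t → ≤-rearrange 1ℝ (t + t) 0ℝ (t + t + - 1ℝ) (double≥1 t (<⇒≤ ½ t ½<t)) λ n →
      solve 1 (λ t → con 0ℚ :+ (t :+ t) := t :+ t :+ :- con 1ℚ :+ con 1ℚ) refl (seq t n))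
    (λ _ → ≤-refl 0ℝ)

  -- With `fall≥0` this bounds `fall` below by both of its branches, so `rise-fall-cover` has to
  -- split on one variable only.
  fall≥2t-1 : ∀ t → t + t + - 1ℝ ≤ fall t
  fall≥2t-1 t = rise-fall-elim (λ _ f → t + t + - 1ℝ ≤ f) t
    (λ _ → ≤-refl (t + t + - 1ℝ))
    (λ t≤½ → ≤-rearrange (t + t) 1ℝ (t + t + - 1ℝ) 0ℝ (double≤1 t t≤½) λ n →
      solve 1 (λ t → t :+ t :+ :- con 1ℚ :+ con 1ℚ := con 0ℚ :+ (t :+ t)) refl (seq t n))

  InUnit : ℝ → Set
  InUnit t = 0ℝ ≤ t × t ≤ 1ℝ

  rise-unit : ∀ t → InUnit t → InUnit (rise t)
  rise-unit t (0≤t , t≤1) = rise-fall-elim (λ r _ → InUnit r) t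
    (λ _ → 0≤1 , ≤-refl 1ℝ)
    (λ t≤½ → +-mono-≤ 0ℝ t 0ℝ t 0≤t 0≤t , double≤1 t t≤½)

  fall≤1 : ∀ t → t ≤ 1ℝ → fall t ≤ 1ℝ
  fall≤1 t t≤1 = rise-fall-elim (λ _ f → f ≤ 1ℝ) t
    (λ _ → ≤-rearrange (t + t) (1ℝ + 1ℝ) (t + t + - 1ℝ) 1ℝ (+-mono-≤ t 1ℝ t 1ℝ t≤1 t≤1) λ n →
      solve 1 (λ t → t :+ t :+ :- con 1ℚ :+ (con 1ℚ :+ con 1ℚ) := con 1ℚ :+ (t :+ t)) refl (seq t n))
    (λ _ → 0≤1)

  fall-unit : ∀ t → InUnit t → InUnit (fall t)
  fall-unit t (_ , t≤1) = fall≥0 t , fall≤1 t t≤1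

  -- If a > ½, then `rise a` is 1 and `fall b` is nonnegative. Otherwise the sum is at least 2a +
  -- (2b - 1) = 2(a + b) - 1 ≥ 1.
  rise-fall-cover : ∀ a b → 1ℝ ≤ a + b → 1ℝ ≤ rise a + fall b
  rise-fall-cover a b 1≤a+b = rise-fall-elim (λ r _ → 1ℝ ≤ r + fall b) a
    (λ _ → +-mono-≤ 1ℝ 1ℝ 0ℝ (fall b) (≤-refl 1ℝ) (fall≥0 b))
    (λ _ → ≤-trans 1ℝ (a + a + (b + b + - 1ℝ)) (a + a + fall b)
      (≤-rearrange (1ℝ + 1ℝ) (a + b + (a + b)) 1ℝ (a + a + (b + b + - 1ℝ))
        (+-mono-≤ 1ℝ (a + b) 1ℝ (a + b) 1≤a+b 1≤a+b)
        (λ n → solve 2 (λ a b → con 1ℚ :+ (a :+ b :+ (a :+ b))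
                             := a :+ a :+ (b :+ b :+ :- con 1ℚ) :+ (con 1ℚ :+ con 1ℚ))
                 refl (seq a n) (seq b n)))
      (+-mono-≤ (a + a) (a + a) (b + b + - 1ℝ) (fall b) (≤-refl (a + a)) (fall≥2t-1 b)))

  fall-rise-cover : ∀ a b → 1ℝ ≤ a + b → 1ℝ ≤ fall a + rise b
  fall-rise-cover a b 1≤a+b = ≤-trans 1ℝ (rise b + fall a) (fall a + rise b)
    (rise-fall-cover b a (≤-trans 1ℝ (a + b) (b + a) 1≤a+b (comm a b)))
    (comm (rise b) (fall a))
    where
    comm : ∀ x y → x + y ≤ y + x
    comm x y = ≡⇒≤ (x + y) (y + x) (λ n → ℚₚ.+-comm (seq x n) (seq y n))

  -- The equation reads 1 = t above ½ and 2t = t below.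
  rise-fixed : ∀ t → rise t ≈ t → t ≈ 0ℝ ⊎ t ≈ 1ℝ
  rise-fixed t = rise-fall-elim (λ r _ → r ≈ t → t ≈ 0ℝ ⊎ t ≈ 1ℝ) t
    (λ _ (r≤ , ≤r) → inj₂ (≤r , r≤))
    (λ _ (r≤ , ≤r) → inj₁
      ( ≤-rearrange (t + t) t t 0ℝ r≤
          (λ n → solve 1 (λ t → t :+ t := con 0ℚ :+ (t :+ t)) refl (seq t n))
      , ≤-rearrange t (t + t) 0ℝ t ≤r
          (λ n → solve 1 (λ t → con 0ℚ :+ (t :+ t) := t :+ t) refl (seq t n))))

  -- The equation reads 2t - 1 = t above ½ and 0 = t below.
  fall-fixed : ∀ t → fall t ≈ t → t ≈ 0ℝ ⊎ t ≈ 1ℝ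
  fall-fixed t = rise-fall-elim (λ _ f → f ≈ t → t ≈ 0ℝ ⊎ t ≈ 1ℝ) t
    (λ _ (f≤ , ≤f) → inj₂
      ( ≤-rearrange (t + t + - 1ℝ) t t 1ℝ f≤
          (λ n → solve 1 (λ t → t :+ t := con 1ℚ :+ (t :+ t :+ :- con 1ℚ)) refl (seq t n))
      , ≤-rearrange t (t + t + - 1ℝ) 1ℝ t ≤f
          (λ n → solve 1 (λ t → con 1ℚ :+ (t :+ t :+ :- con 1ℚ) := t :+ t) refl (seq t n))))
    (λ _ (f≤ , ≤f) → inj₁ (≤f , f≤))

  -- Moving a cover along the bipartition

  module _ {X : Set} {F : SigmaAlgebra X} (ν : ProbabilityMeasure F) (c : L∞ ν) where

    -- The composite unfolds to a piecewise function on X, split along the superlevel set of c at ½.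
    isMeasurable-rise : IsMeasurable F (λ x → rise (fun c x))
    isMeasurable-rise = isMeasurable-piecewise F
      {f = λ _ → 1ℝ} {g = λ x → fun c x + fun c x} (L∞.measurable c ½)
      (isMeasurable-const F 1ℝ) (isMeasurable-double F {fun c} (L∞.measurable c))

    isMeasurable-fall : IsMeasurable F (λ x → fall (fun c x))
    isMeasurable-fall = isMeasurable-piecewise F
      {f = λ x → fun c x + fun c x + - 1ℝ} {g = λ _ → 0ℝ} (L∞.measurable c ½)
      (isMeasurable-shift F {λ x → fun c x + fun c x} 1ℝ
        (isMeasurable-double F {fun c} (L∞.measurable c)))
      (isMeasurable-const F 0ℝ)

    unit⇒bounded : ∀ t → InUnit t → - 1ℝ ≤ t × t ≤ 1ℝ
    unit⇒bounded t (0≤t , t≤1) = ≤-trans (- 1ℝ) 0ℝ t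
      (≤-rearrange 0ℝ 1ℝ (- 1ℝ) 0ℝ 0≤1 (λ _ → refl)) 0≤t , t≤1

    module _ {A : Pred X 0ℓ} (a : Measurable F A) (f g : ℝ → ℝ)
      (mf : IsMeasurable F (λ x → f (fun c x))) (mg : IsMeasurable F (λ x → g (fun c x)))
      (f-unit : ∀ t → InUnit t → InUnit (f t)) (g-unit : ∀ t → InUnit t → InUnit (g t))
      where

      -- The maps f and g stay abstract so that (`rise`, `fall`) and (`fall`, `rise`) are two
      -- instances of one construction.
      along : X → ℝ
      along = piecewise A (λ x → f (fun c x)) (λ x → g (fun c x))

      along-unit : ∀ x → InUnit (fun c x) → InUnit (along x)
      along-unit x u with em {A x}
      ... | yes _ = f-unit (fun c x) u
      ... | no  _ = g-unit (fun c x) u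

      along-L∞ : AlmostEverywhere ν (λ x → InUnit (fun c x)) → L∞ ν
      along-L∞ unit = record
        { fun        = along
        ; measurable = isMeasurable-piecewise F {f = λ x → f (fun c x)} {λ x → g (fun c x)} a mf mg
        ; essBounded = 1ℝ , null-⊆ ν (λ {x} ¬b u → ¬b (unit⇒bounded (along x) (along-unit x u))) unit
        }

      -- Consider a pair in the support at which the new function fails to cover. If both points lie
      -- in A, or both outside A and hence in B, the pair belongs to a null set by bipartiteness. If
      -- A separates them, `fg` or `gf` shows that c failed there already. Three null sets thus
      -- contain all failures.
      along-cover : (ν² : ProbabilityMeasure (F ⊗ F)) (W : Graphon F) {B : Pred X 0ℓ} →
        (∀ x → x ∈ A ⊎ x ∈ B) → VanishesOn ν² W A → VanishesOn ν² W B →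
        (∀ s t → 1ℝ ≤ s + t → 1ℝ ≤ f s + g t) → (∀ s t → 1ℝ ≤ s + t → 1ℝ ≤ g s + f t) →
        ((unit , _) : FCOV ν² W ν c) → FCOV ν² W ν (along-L∞ unit)
      along-cover ν² W {B} A∪B vA vB fg gf (unit , covered) =
          null-⊆ ν (λ {x} ¬h u → ¬h (along-unit x u)) unit
        , null-⊆ ν² uncovered (null-∪ ν² covered (null-∪ ν² vA vB))
        where
        open Graphon W using (supp) renaming (W to w)
        zero-free : ∀ p → p ∈ supp → ¬ (w p ≈ 0ℝ)
        zero-free p p∈supp (w≤0 , _) = <⇒≱ 0ℝ (w p) p∈supp w≤0
        ∉A⇒∈B : ∀ x → ¬ (x ∈ A) → x ∈ B
        ∉A⇒∈B x x∉A with A∪B x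
        ... | inj₁ x∈A = ⊥-elim (x∉A x∈A)
        ... | inj₂ x∈B = x∈B
        uncovered : supp ∖ (λ (x , y) → 1ℝ ≤ along x + along y)
          ⊆ (supp ∖ (λ (x , y) → 1ℝ ≤ fun c x + fun c y))
            ∪ (((A ⟨×⟩ A) ∖ (λ p → w p ≈ 0ℝ)) ∪ ((B ⟨×⟩ B) ∖ (λ p → w p ≈ 0ℝ)))
        uncovered {x , y} (p∈supp , ¬h) with em {A x} | em {A y}
        ... | yes x∈A | yes y∈A = inj₂ (inj₁ ((x∈A , y∈A) , zero-free (x , y) p∈supp))
        ... | yes _   | no _    = inj₁ (p∈supp , λ h → ¬h (fg (fun c x) (fun c y) h))
        ... | no _    | yes _   = inj₁ (p∈supp , λ h → ¬h (gf (fun c x) (fun c y) h))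
        ... | no x∉A  | no y∉A  =
          inj₂ (inj₂ ((∉A⇒∈B x x∉A , ∉A⇒∈B y y∉A) , zero-free (x , y) p∈supp))

  -- Integrality of extreme covers

  extreme⇒integral : {X : Set} {F : SigmaAlgebra X} (ν : ProbabilityMeasure F)
    (ν² : ProbabilityMeasure (F ⊗ F)) (W : Graphon F) → IsBipartite ν² W →
    (c : L∞ ν) → IsExtremePoint ν (FCOV ν² W ν) c →
    AlmostEverywhere ν (λ x → fun c x ≈ 0ℝ ⊎ fun c x ≈ 1ℝ)
  extreme⇒integral ν ν² W (Ω₁ , Ω₂ , m₁ , _ , Ω₁∪Ω₂ , _ , v₁ , v₂) c (cov , extreme) =
    null-⊆ ν (λ {x} ¬01 fixed → ¬01 (integral x fixed))
      (proj₁ (extreme c′ c″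
        (along-cover ν c m₁ rise fall mr mf rise-unit fall-unit ν² W Ω₁∪Ω₂ v₁ v₂
          rise-fall-cover fall-rise-cover cov)
        (along-cover ν c m₁ fall rise mf mr fall-unit rise-unit ν² W Ω₁∪Ω₂ v₁ v₂
          fall-rise-cover rise-fall-cover cov)
        -- The midpoint identity holds at every point, so its exceptional set is contained in ∅.
        (null-⊆ ν (λ {x} ¬avg → ¬avg (average x)) (null-∅ ν))))
    where
    mr = isMeasurable-rise ν c
    mf = isMeasurable-fall ν c
    c′ c″ : L∞ ν
    c′ = along-L∞ ν c m₁ rise fall mr mf rise-unit fall-unit (proj₁ cov)
    c″ = along-L∞ ν c m₁ fall rise mf mr fall-unit rise-unit (proj₁ cov)
    rise∘c fall∘c : _ → ℝ
    rise∘c x = rise (fun c x)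
    fall∘c x = fall (fun c x)
    average : ∀ x → fun c x ≈ ½ * (fun c′ x + fun c″ x)
    -- Both covers split along Ω₁ with the two maps exchanged, so on either side one value is the
    -- rise and the other the fall.
    average x = piecewise-elim Ω₁ rise∘c fall∘c fall∘c rise∘c
      (λ s t → fun c x ≈ ½ * (s + t)) x
      (λ _ → rise-fall-average (fun c x)) (λ _ → fall-rise-average (fun c x))
    integral : ∀ x → fun c′ x ≈ fun c x → fun c x ≈ 0ℝ ⊎ fun c x ≈ 1ℝ
    integral x = piecewise-elim Ω₁ rise∘c fall∘c fall∘c rise∘c
      (λ s _ → s ≈ fun c x → fun c x ≈ 0ℝ ⊎ fun c x ≈ 1ℝ) x
      (λ _ → rise-fixed (fun c x)) (λ _ → fall-fixed (fun c x))

theorem14 : ExcludedMiddle 0ℓ →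
    (Ω : Setoid 0ℓ 0ℓ) (F : SigmaAlgebra (Setoid.Carrier Ω)) (ν : ProbabilityMeasure F) →
    IsStandardBorel Ω F →
    Atomless ν →
    (ν² : ProbabilityMeasure (F ⊗ F)) →
    IsProductMeasure ν ν ν² →
    (W : Graphon F) →
    IsBipartite ν² W →
    (c : L∞ ν) →
    IsExtremePoint ν (FCOV ν² W ν) c →
    AlmostEverywhere ν (λ x → fun c x ≈ 0ℝ ⊎ fun c x ≈ 1ℝ)
theorem14 em _ _ ν _ _ ν² _ = Classical.extreme⇒integral em ν ν²
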